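{- For all natural numbers $r, n, \delta \geq 2$, there exists a $d$-regular graph $G = G(r,n,\delta)$ with $d > \delta$, $\chi(G) = n$ and $\chi_r(G) = r\,\chi(G)$.
   Context: All graphs are finite and simple. A proper $k$-colouring of a graph $G$ is a map $c\colon V(G)\to[k]$ with $c(u)\neq c(v)$ for every edge $uv$; $\chi(G)$ is the chromatic number. For an integer $r\ge 1$, an $r$-dynamic $k$-colouring of $G$ is a proper $k$-colouring $c$ such that for every vertex $v$, the set $c(N(v))$ of colours used on the neighbourhood $N(v)$ has size at least $\min\{r, d(v)\}$, where $d(v)$ is the degree of $v$. The $r$-dynamic chromatic number $\chi_r(G)$ is the least $k$ such that $G$ has an $r$-dynamic $k$-colouring. -}

module Defs where

open import Data.Fin using (Fin; _≟_)
open import Data.Fin.Properties using (any?)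
open import Data.Fin.Subset using (Subset; ∣_∣)
open import Data.Fin.Subset.Properties using (_∈?_)
open import Data.Nat using (ℕ; _≤_; _⊓_)
open import Data.Product using (_×_; ∃-syntax)
open import Data.Vec using (tabulate)
open import Function using (_∘_)
open import Level using (0ℓ)
open import Relation.Binary.Core using (Rel)
open import Relation.Binary.Definitions using (Symmetric; Irreflexive)
import Relation.Binary.Definitions as Binary
open import Relation.Binary.PropositionalEquality using (_≡_; _≢_)
open import Relation.Nullary.Decidable using (does; _×-dec_)
open import Relation.Unary using (Pred; Decidable)

-- Adjacency is decidable so that neighbourhoods are finite subsets with a
-- cardinality.
record Graph : Set₁ where
  field
    order  : ℕ
    Adj    : Rel (Fin order) 0ℓ
    adj?   : Binary.Decidable Adj
    sym    : Symmetric Adj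
    irrefl : Irreflexive _≡_ Adj

  Vertex : Set
  Vertex = Fin order

comprehension : ∀ {n} {P : Pred (Fin n) 0ℓ} → Decidable P → Subset n
comprehension P? = tabulate (does ∘ P?)

image : ∀ {m n} → (Fin m → Fin n) → Subset m → Subset n
image f p = comprehension (λ i → any? (λ u → (u ∈? p) ×-dec (f u ≟ i)))

module _ (G : Graph) where
  open Graph G

  N : Vertex → Subset order
  N v = comprehension (adj? v)

  degree : Vertex → ℕ
  degree v = ∣ N v ∣

  Regular : ℕ → Set
  Regular d = ∀ v → degree v ≡ d

  Proper : ∀ {k} → (Vertex → Fin k) → Set
  Proper c = ∀ {u v} → Adj u v → c u ≢ c v

  Dynamic : ℕ → ∀ {k} → (Vertex → Fin k) → Set
  Dynamic r c = Proper c × (∀ v → r ⊓ degree v ≤ ∣ image c (N v) ∣)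

  Colourable : ℕ → Set
  Colourable k = ∃[ c ] Proper {k} c

  DynamicColourable : ℕ → ℕ → Set
  DynamicColourable r k = ∃[ c ] Dynamic r {k} c

IsLeast : Pred ℕ 0ℓ → ℕ → Set
IsLeast P k = P k × (∀ {m} → P m → k ≤ m)

-- χ(G) = k and χ_r(G) = k, as relations between the graph and the number k,
-- which IsLeast determines uniquely.
ChromaticNumber : Graph → ℕ → Set
ChromaticNumber G k = IsLeast (Colourable G) k

DynamicChromaticNumber : ℕ → Graph → ℕ → Set
DynamicChromaticNumber r G k = IsLeast (DynamicColourable G r) k

{-# OPTIONS --safe #-}
module Submission where

-- Take L copies of the complete n-partite graph with parts of size m, and hubs:
-- a hub belongs to a part i and to n distinct copies, and is joined to the i-th
-- part of each of these copies.  In a colouring with fewer than rn colours, each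
-- copy has one of a bounded number of palettes (which colours occur on which
-- part), so for large L some n copies have equal palettes.  The hubs of these n
-- copies see on their neighbourhoods only the colours of a single copy, so every
-- part of that copy carries at least r colours; distinct parts of a copy share no
-- colour, so there are at least rn colours after all.  Indexing the copies by
-- ℤ/L and using all translates of each choice of n copies puts every copy in
-- equally many choices, so that m can be chosen to make the graph regular.

open import Defs
open import Data.Bool using (if_then_else_)
open import Data.Empty using (⊥)
open import Data.Fin
  using (Fin; zero; suc; toℕ; inject≤; combine; remQuot; punchIn; punchOut; finToFun; funToFin;
    _≟_)
open import Data.Fin.Properties
  using (any?; all?; injective⇒≤; suc-injective; toℕ-injective; toℕ-fromℕ<; toℕ<n; toℕ-inject≤;
    inject≤-injective; combine-injective; punchIn-injective; punchInᵢ≢i; punchIn-punchOut;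
    finToFun-funToFin; remQuot-combine; +↔⊎; *↔×)
open import Data.Fin.Subset using (_∈_; ∣_∣)
open import Data.Fin.Subset.Properties using (_∈?_)
open import Data.Nat
  using (ℕ; zero; suc; NonZero; >-nonZero⁻¹; _≤_; _<_; _+_; _*_; _∸_; _^_; _⊓_; _≤?_; s≤s)
open import Data.Nat.DivMod
  using (_%_; _mod_; %-distribˡ-+; m%n<n; m%n%n≡m%n; m<n⇒m%n≡m; [m+n]%n≡m%n)
open import Data.Nat.Properties
  using (≤-refl; ≤-trans; ≤-<-trans; +-monoˡ-≤; ≤-antisym; ≤-reflexive; ≰⇒>; <⇒≤; <⇒≱; ≮⇒≥;
    m≤m+n; m≤n*m; m+[n∸m]≡n; m⊓n≤m; m≤n⇒m⊓n≡m; +-assoc; +-comm; *-monoˡ-≤; *-monoʳ-≤; ^-monoʳ-≤;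
    m^n≢0)
open import Data.Product using (_×_; _,_; ∃-syntax; proj₁; proj₂)
open import Data.Product.Function.NonDependent.Propositional using (_×-↔_)
open import Data.Sum using (_⊎_; inj₁; inj₂)
open import Data.Sum.Function.Propositional using (_⊎-↔_)
open import Data.Vec.Properties using (lookup∘tabulate; lookup⇒[]=; []=⇒lookup)
open import Function using (_∘_; _↔_; Inverse; Injection; Injective)
open import Function.Construct.Composition using (_↔-∘_)
open import Function.Construct.Identity using (↔-id)
open import Function.Construct.Symmetry using (↔-sym)
open import Function.Properties.Inverse using (↔⇒↣)
open import Level using (0ℓ)
open import Relation.Binary.Core using (Rel)
open import Relation.Binary.Definitions using (Symmetric)
import Relation.Binary.Definitions as Binary
open import Relation.Binary.PropositionalEquality
  using (_≡_; _≢_; refl; sym; trans; cong; subst; module ≡-Reasoning)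
open import Relation.Nullary using (Dec; yes; no; does; ¬_; contradiction)
open import Relation.Nullary.Decidable using (dec-true; _×-dec_; _→-dec_; ¬?)
open import Relation.Unary using (Pred; Decidable)

-- Enumerations of predicates and their sizes.

record Enumeration {A : Set} (B : Set) (P : Pred A 0ℓ) : Set where
  field
    element   : B → A
    -- Injectivity concerns elements alone, so an element at which `P` has many proofs is still
    -- counted once.
    injective : Injective _≡_ _≡_ element
    sound     : ∀ b → P (element b)
    complete  : ∀ {x} → P x → ∃[ b ] element b ≡ x

open Enumeration

reindex : ∀ {A B C : Set} {P : Pred A 0ℓ} → C ↔ B → Enumeration B P → Enumeration C P
reindex C↔B E = record
  { element   = element E ∘ to
  ; injective = λ eq → Injection.injective (↔⇒↣ C↔B) (injective E eq)
  ; sound     = sound E ∘ to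
  ; complete  = λ p → let b , eq = complete E p
                      in from b , trans (cong (element E) (strictlyInverseˡ b)) eq
  } where open Inverse C↔B

pullback : ∀ {A A′ B : Set} {P : Pred A 0ℓ} (A′↔A : A′ ↔ A) →
           Enumeration B P → Enumeration B (P ∘ Inverse.to A′↔A)
pullback {P = P} A′↔A E = record
  { element   = from ∘ element E
  ; injective = λ eq → injective E (Injection.injective (↔⇒↣ (↔-sym A′↔A)) eq)
  ; sound     = λ b → subst P (sym (strictlyInverseˡ _)) (sound E b)
  ; complete  = λ p → let b , eq = complete E p
                      in b , trans (cong from eq) (strictlyInverseʳ _)
  } where open Inverse A′↔A

injection⇒≤ : ∀ {A : Set} {P : Pred A 0ℓ} {k l} → Enumeration (Fin l) P →
              (f : Fin k → A) → Injective _≡_ _≡_ f → (∀ i → P (f i)) → k ≤ l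
injection⇒≤ E f f-inj f∈P = injective⇒≤ {f = λ i → proj₁ (complete E (f∈P i))}
  λ {i} {j} eq → f-inj (trans (sym (proj₂ (complete E (f∈P i))))
                        (trans (cong (element E) eq) (proj₂ (complete E (f∈P j)))))

×-injective⇒*≤ : ∀ {k l o} (f : Fin k × Fin l → Fin o) → (∀ x y → f x ≡ f y → x ≡ y) → k * l ≤ o
×-injective⇒*≤ f f-inj = injective⇒≤ λ eq → Injection.injective (↔⇒↣ *↔×) (f-inj _ _ eq)

size-unique : ∀ {A : Set} {P : Pred A 0ℓ} {k l} →
              Enumeration (Fin k) P → Enumeration (Fin l) P → k ≡ l
size-unique E F = ≤-antisym
  (injection⇒≤ F (element E) (injective E) (sound E))
  (injection⇒≤ E (element F) (injective F) (sound F))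

enumerate : ∀ {n} {P : Pred (Fin n) 0ℓ} (P? : Decidable P) →
            Enumeration (Fin ∣ comprehension P? ∣) P
enumerate {zero}  P? = record
  { element = λ () ; injective = λ {} ; sound = λ () ; complete = λ { {()} } }
enumerate {suc n} P? with P? zero | enumerate (P? ∘ suc)
... | yes p | E = record
  { element   = λ { zero → zero ; (suc i) → suc (element E i) }
  ; injective = λ { {zero} {zero} _ → refl
                  ; {suc i} {suc j} eq → cong suc (injective E (suc-injective eq)) }
  ; sound     = λ { zero → p ; (suc i) → sound E i }
  ; complete  = λ { {zero} _ → zero , refl
                  ; {suc x} q → let i , eq = complete E q in suc i , cong suc eq }
  }
... | no ¬p | E = record
  { element   = suc ∘ element E
  ; injective = λ eq → injective E (suc-injective eq)
  ; sound     = sound E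
  ; complete  = λ { {zero} p → contradiction p ¬p
                  ; {suc x} q → let i , eq = complete E q in i , cong suc eq }
  }

-- Membership in comprehensions, pigeonhole principle, codes of subsets.

module _ {n} {P : Pred (Fin n) 0ℓ} (P? : Decidable P) where

  ∈-comprehension⁺ : ∀ {x} → P x → x ∈ comprehension P?
  ∈-comprehension⁺ {x} p =
    lookup⇒[]= x _ (trans (lookup∘tabulate (does ∘ P?) x) (dec-true (P? x) p))

  ∈-comprehension⁻ : ∀ {x} → x ∈ comprehension P? → P x
  ∈-comprehension⁻ {x} x∈ with P? x | trans (sym (lookup∘tabulate (does ∘ P?) x)) ([]=⇒lookup x∈)
  ... | yes p | _  = p
  ... | no _  | ()

-- If every class had at most `s` elements, then sending `x` to its class and its position there
-- would inject `Fin L` into `Fin (K * s)`.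
strong-pigeonhole : ∀ {K L s} → K * s < L → (f : Fin L → Fin K) →
                    ∃[ κ ] suc s ≤ ∣ comprehension (λ x → f x ≟ κ) ∣
strong-pigeonhole {K} {L} {s} Ks<L f with any? (λ κ → suc s ≤? ∣ comprehension (λ x → f x ≟ κ) ∣)
... | yes found = found
... | no ¬found = contradiction (injective⇒≤ rank-injective) (<⇒≱ Ks<L)
  where
  class : ∀ κ → Enumeration (Fin ∣ comprehension (λ x → f x ≟ κ) ∣) (λ x → f x ≡ κ)
  class κ = enumerate (λ x → f x ≟ κ)

  small : ∀ κ → ∣ comprehension (λ x → f x ≟ κ) ∣ ≤ s
  small κ with suc s ≤? ∣ comprehension (λ x → f x ≟ κ) ∣
  ... | yes large = contradiction (κ , large) ¬found
  ... | no ¬large with ≰⇒> ¬large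
  ...   | s≤s le = le

  position : ∀ x → Fin s
  position x = inject≤ (proj₁ (complete (class (f x)) refl)) (small (f x))

  -- The classes are variables here so that their equality can be matched with `refl`, which
  -- `f x ≡ f y` does not allow.
  class-position : ∀ {κ λ′ x y} (fx : f x ≡ κ) (fy : f y ≡ λ′) → κ ≡ λ′ →
                   inject≤ (proj₁ (complete (class κ) fx)) (small κ) ≡
                   inject≤ (proj₁ (complete (class λ′) fy)) (small λ′) → x ≡ y
  class-position {κ} fx fy refl eq =
    trans (sym (proj₂ (complete (class κ) fx)))
      (trans (cong (element (class κ)) (inject≤-injective (small κ) (small κ) _ _ eq))
             (proj₂ (complete (class κ) fy)))

  rank-injective : Injective _≡_ _≡_ (λ x → combine (f x) (position x))
  rank-injective {x} {y} eq with combine-injective (f x) _ (f y) _ eq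
  ... | f≡ , position≡ = class-position refl refl f≡ position≡

module _ {n} {P : Pred (Fin n) 0ℓ} (P? : Decidable P) where

  indicator : Fin n → Fin 2
  indicator x = if does (P? x) then suc zero else zero

  code : Fin (2 ^ n)
  code = funToFin indicator

-- `finToFun` recovers the indicator from the code, so equal codes force equal indicators at each
-- point.
code-⊆ : ∀ {n} {P Q : Pred (Fin n) 0ℓ} (P? : Decidable P) (Q? : Decidable Q) →
         code P? ≡ code Q? → ∀ x → P x → Q x
code-⊆ P? Q? eq x p with P? x | Q? x | indicator≡
  where
  indicator≡ : indicator P? x ≡ indicator Q? x
  indicator≡ = trans (sym (finToFun-funToFin (indicator P?) x))
    (trans (cong (λ z → finToFun z x) eq) (finToFun-funToFin (indicator Q?) x))
... | yes _ | yes q | _ = q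
... | no ¬p | _     | _ = contradiction p ¬p

transfer : ∀ {A B : Set} {P Q : Pred A 0ℓ} → (∀ {x} → P x → Q x) → (∀ {x} → Q x → P x) →
           Enumeration B P → Enumeration B Q
transfer P⊆Q Q⊆P E = record
  { element   = element E
  ; injective = injective E
  ; sound     = P⊆Q ∘ sound E
  ; complete  = complete E ∘ Q⊆P
  }

-- Addition and subtraction modulo L.

module Cyclic (L : ℕ) .{{_ : NonZero L}} where

  infixl 6 _⊕_ _⊖_

  _⊕_ _⊖_ : Fin L → Fin L → Fin L
  x ⊕ y = (toℕ x + toℕ y) mod L
  x ⊖ y = (toℕ x + (L ∸ toℕ y)) mod L

  private
    mod-absorbˡ : ∀ a b → (a % L + b) % L ≡ (a + b) % L
    mod-absorbˡ a b = begin
      (a % L + b) % L          ≡⟨ %-distribˡ-+ (a % L) b L ⟩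
      (a % L % L + b % L) % L  ≡⟨ cong (λ z → (z + b % L) % L) (m%n%n≡m%n a L) ⟩
      (a % L + b % L) % L      ≡⟨ %-distribˡ-+ a b L ⟨
      (a + b) % L              ∎
      where open ≡-Reasoning

    -- Two successive shifts with total `L` amount to a full turn; both orders of adding and
    -- subtracting `y` are instances.
    cancel : ∀ (x : Fin L) {b c} → b + c ≡ L →
             (toℕ ((toℕ x + b) mod L) + c) mod L ≡ x
    cancel x {b} {c} b+c≡L = toℕ-injective (begin
      toℕ ((toℕ ((toℕ x + b) mod L) + c) mod L)  ≡⟨ toℕ-fromℕ< _ ⟩
      (toℕ ((toℕ x + b) mod L) + c) % L          ≡⟨ cong (λ z → (z + c) % L) (toℕ-fromℕ< _) ⟩
      ((toℕ x + b) % L + c) % L                  ≡⟨ mod-absorbˡ (toℕ x + b) c ⟩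
      (toℕ x + b + c) % L                        ≡⟨ cong (_% L) (+-assoc (toℕ x) b c) ⟩
      (toℕ x + (b + c)) % L                      ≡⟨ cong (λ z → (toℕ x + z) % L) b+c≡L ⟩
      (toℕ x + L) % L                            ≡⟨ [m+n]%n≡m%n (toℕ x) L ⟩
      toℕ x % L                                  ≡⟨ m<n⇒m%n≡m (toℕ<n x) ⟩
      toℕ x                                      ∎)
      where open ≡-Reasoning

  ⊕-⊖ : ∀ x y → x ⊕ y ⊖ y ≡ x
  ⊕-⊖ x y = cancel x (m+[n∸m]≡n (<⇒≤ (toℕ<n y)))

  ⊖-⊕ : ∀ x y → x ⊖ y ⊕ y ≡ x
  ⊖-⊕ x y = cancel x (trans (+-comm (L ∸ toℕ y) (toℕ y)) (m+[n∸m]≡n (<⇒≤ (toℕ<n y))))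

  0# : Fin L
  0# = 0 mod L

  ⊕-identityˡ : ∀ y → 0# ⊕ y ≡ y
  ⊕-identityˡ y = toℕ-injective (begin
    toℕ (0# ⊕ y)         ≡⟨ toℕ-fromℕ< _ ⟩
    (toℕ 0# + toℕ y) % L ≡⟨ cong (λ z → (z + toℕ y) % L) (toℕ-fromℕ< (m%n<n 0 L)) ⟩
    (0 % L + toℕ y) % L  ≡⟨ mod-absorbˡ 0 (toℕ y) ⟩
    toℕ y % L            ≡⟨ m<n⇒m%n≡m (toℕ<n y) ⟩
    toℕ y                ∎)
    where open ≡-Reasoning

  ⊕-comm : ∀ x y → x ⊕ y ≡ y ⊕ x
  ⊕-comm x y = cong (_mod L) (+-comm (toℕ x) (toℕ y))

  ⊕-cancelʳ : ∀ {x y} z → x ⊕ z ≡ y ⊕ z → x ≡ y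
  ⊕-cancelʳ {x} {y} z eq = trans (sym (⊕-⊖ x z)) (trans (cong (_⊖ z) eq) (⊕-⊖ y z))

  ⊕-cancelˡ : ∀ x {y z} → x ⊕ y ≡ x ⊕ z → y ≡ z
  ⊕-cancelˡ x {y} {z} eq = ⊕-cancelʳ x (trans (⊕-comm y x) (trans eq (⊕-comm x z)))

  ⊖-cancelˡ : ∀ x {y z} → x ⊖ y ≡ x ⊖ z → y ≡ z
  ⊖-cancelˡ x {y} {z} eq =
    ⊕-cancelˡ (x ⊖ y) (trans (⊖-⊕ x y) (sym (trans (cong (_⊕ z) eq) (⊖-⊕ x z))))

-- Graphs on a structured vertex type.

module EncodedGraph {A : Set} {order : ℕ} (enc : Fin order ↔ A) {_~_ : Rel A 0ℓ}
  (_~?_ : Binary.Decidable _~_) (~-sym : Symmetric _~_) (~-irrefl : ∀ {x} → ¬ (x ~ x)) where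

  open Inverse enc

  graph : Graph
  graph = record
    { order  = order
    ; Adj    = λ u v → to u ~ to v
    ; adj?   = λ u v → to u ~? to v
    ; sym    = ~-sym
    ; irrefl = λ { refl → ~-irrefl }
    }

  degree≡ : ∀ {d} v → Enumeration (Fin d) (to v ~_) → degree graph v ≡ d
  degree≡ v E = size-unique (enumerate (λ u → to v ~? to u)) (pullback enc E)

  ~⇒Adj : ∀ {x y} → x ~ y → to (from x) ~ to (from y)
  ~⇒Adj {x} {y} x~y rewrite strictlyInverseˡ x | strictlyInverseˡ y = x~y

  to∘from : ∀ x → to (from x) ≡ x
  to∘from = strictlyInverseˡ

  -- Turns bounds on the number of colours around `v` into statements about structured vertices, for
  -- both the upper and the lower bound.
  neighbour-colours : ∀ {k} (c : Fin order → Fin k) v →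
    Enumeration (Fin ∣ image c (N graph v) ∣) (λ κ → ∃[ y ] (to v ~ y × c (from y) ≡ κ))
  neighbour-colours c v = transfer
    (λ { (u , u∈N , refl) → to u , ∈-comprehension⁻ adj u∈N , cong c (strictlyInverseʳ u) })
    (λ { (y , v~y , refl) → from y
                          , ∈-comprehension⁺ adj (subst (to v ~_) (sym (strictlyInverseˡ y)) v~y)
                          , refl })
    (enumerate (λ κ → any? (λ u → (u ∈? N graph v) ×-dec (c u ≟ κ))))
    where
    adj : Decidable (λ u → to v ~ to u)
    adj u = to v ~? to u

-- The graph of cores and hubs.

module Construction (n₁ q L E : ℕ) .{{_ : NonZero L}} (offset : Fin E → Fin (suc (suc n₁)) → Fin L)
  (offset-injective : ∀ e → Injective _≡_ _≡_ (offset e)) where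

  open Cyclic L

  n₀ n m : ℕ
  n₀ = suc n₁
  n = suc n₀
  -- A core vertex has n₀ * m core neighbours and E * (n * q) hub neighbours, a
  -- hub has n * m neighbours; this m makes the two degrees agree.
  m = E * (n * q)

  -- A core vertex has a part, a copy and a position in the part. A hub has a part, a translation
  -- `x`, a choice `e` of `n` copies, and an index among `q` twins; `q` is a free factor that makes
  -- `m` large.
  Vertex : Set
  Vertex = (Fin n × Fin L × Fin m) ⊎ (Fin n × (Fin L × Fin E) × Fin q)

  pattern core i y a = inj₁ (i , y , a)
  pattern hub i x e b = inj₂ (i , (x , e) , b)

  Incident : Fin L → Fin E → Fin L → Set
  Incident x e y = ∃[ j ] x ⊕ offset e j ≡ y

  _~_ : Rel Vertex 0ℓ
  core i y _  ~ core i′ y′ _ = i ≢ i′ × y ≡ y′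
  core i y _  ~ hub i′ x e _ = i′ ≡ i × Incident x e y
  hub i x e _ ~ core i′ y _  = i ≡ i′ × Incident x e y
  hub _ _ _ _ ~ hub _ _ _ _  = ⊥

  incident? : ∀ x e y → Dec (Incident x e y)
  incident? x e y = any? (λ j → x ⊕ offset e j ≟ y)

  _~?_ : Binary.Decidable _~_
  core i y _  ~? core i′ y′ _ = ¬? (i ≟ i′) ×-dec (y ≟ y′)
  core i y _  ~? hub i′ x e _ = (i′ ≟ i) ×-dec incident? x e y
  hub i x e _ ~? core i′ y _  = (i ≟ i′) ×-dec incident? x e y
  hub _ _ _ _ ~? hub _ _ _ _  = no λ ()

  ~-sym : Symmetric _~_
  ~-sym {core _ _ _}  {core _ _ _}  (i≢ , y≡) = i≢ ∘ sym , sym y≡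
  ~-sym {core _ _ _}  {hub _ _ _ _} p         = p
  ~-sym {hub _ _ _ _} {core _ _ _}  p         = p

  ~-irrefl : ∀ {v} → ¬ (v ~ v)
  ~-irrefl {core _ _ _}  (i≢i , _) = i≢i refl
  ~-irrefl {hub _ _ _ _} ()

  abstract
    encoding : Fin (n * (L * m) + n * ((L * E) * q)) ↔ Vertex
    encoding = (cores ⊎-↔ hubs) ↔-∘ +↔⊎
      where
      cores : Fin (n * (L * m)) ↔ (Fin n × Fin L × Fin m)
      cores = (↔-id _ ×-↔ *↔×) ↔-∘ *↔×

      hubs : Fin (n * ((L * E) * q)) ↔ (Fin n × (Fin L × Fin E) × Fin q)
      hubs = (↔-id _ ×-↔ ((*↔× ×-↔ ↔-id _) ↔-∘ *↔×)) ↔-∘ *↔×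

  open EncodedGraph encoding _~?_ ~-sym (λ {v} → ~-irrefl {v}) public

  core-injective : ∀ {i i′ : Fin n} {y y′ : Fin L} {a a′ : Fin m} →
                   _≡_ {A = Vertex} (core i y a) (core i′ y′ a′) → i ≡ i′ × y ≡ y′ × a ≡ a′
  core-injective refl = refl , refl , refl

  hub-injective : ∀ {i i′ : Fin n} {x x′ : Fin L} {e e′ : Fin E} {b b′ : Fin q} →
                  _≡_ {A = Vertex} (hub i x e b) (hub i′ x′ e′ b′) → x ≡ x′ × e ≡ e′ × b ≡ b′
  hub-injective refl = refl , refl , refl

  -- Neighbourhoods and regularity.

  core-neighbours : ∀ i y a →
    Enumeration ((Fin E × Fin n × Fin q) ⊎ (Fin n₀ × Fin m)) (core i y a ~_)
  core-neighbours i y a = record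
    { element   = el
    ; injective = λ {s} {t} → inj s t
    ; sound     = λ { (inj₁ (e , j , b)) → refl , j , ⊖-⊕ y (offset e j)
                    ; (inj₂ (i′ , a′)) → punchInᵢ≢i i i′ ∘ sym , refl }
    ; complete  = λ {v} → comp v
    }
    where
    el : (Fin E × Fin n × Fin q) ⊎ (Fin n₀ × Fin m) → Vertex
    -- Exactly one translate of choice `e` has `y` as its `j`-th copy, so the number of hub
    -- neighbours does not depend on `y`.
    el (inj₁ (e , j , b)) = hub i (y ⊖ offset e j) e b
    el (inj₂ (i′ , a′))   = core (punchIn i i′) y a′

    inj : ∀ s t → el s ≡ el t → s ≡ t
    inj (inj₁ (e , j , b)) (inj₁ (e′ , j′ , b′)) eq with hub-injective eq
    ... | x≡ , refl , refl with offset-injective e (⊖-cancelˡ y x≡)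
    ...   | refl = refl
    inj (inj₂ (i₁ , a₁)) (inj₂ (i₂ , a₂)) eq with core-injective eq
    ... | p , _ , refl with punchIn-injective i i₁ i₂ p
    ...   | refl = refl

    comp : ∀ v → core i y a ~ v → ∃[ s ] el s ≡ v
    comp (core i′ .y a′) (i≢i′ , refl) =
      inj₂ (punchOut i≢i′ , a′) , cong (λ z → core z y a′) (punchIn-punchOut i≢i′)
    comp (hub .i x e b) (refl , j , eq) =
      inj₁ (e , j , b) ,
      cong (λ z → hub i z e b) (trans (cong (_⊖ offset e j) (sym eq)) (⊕-⊖ x (offset e j)))

  hub-neighbours : ∀ i x e b → Enumeration (Fin n × Fin m) (hub i x e b ~_)
  hub-neighbours i x e b = record
    { element   = el
    ; injective = λ {s} {t} → inj s t
    ; sound     = λ { (j , a) → refl , j , refl }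
    ; complete  = λ { {core _ _ a} (refl , j , refl) → (j , a) , refl }
    }
    where
    el : Fin n × Fin m → Vertex
    el (j , a) = core i (x ⊕ offset e j) a

    inj : ∀ s t → el s ≡ el t → s ≡ t
    inj (j , a) (j′ , a′) eq with core-injective eq
    ... | _ , y≡ , refl with offset-injective e (⊕-cancelˡ x y≡)
    ...   | refl = refl

  regular : Regular graph (n * m)
  regular v = degree≡ v (neighbours (Inverse.to encoding v))
    where
    neighbours : ∀ v → Enumeration (Fin (n * m)) (v ~_)
    neighbours (core i y a)  =
      -- The count `E * (n * q) + n₀ * m` is `m + n₀ * m`, which is `n * m` by definition.
      reindex ((((↔-id _ ×-↔ *↔×) ↔-∘ *↔×) ⊎-↔ *↔×) ↔-∘ +↔⊎) (core-neighbours i y a)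
    neighbours (hub i x e b) = reindex *↔× (hub-neighbours i x e b)

  open Inverse encoding using (to; from)

  core-parts-differ : ∀ {k} {c : Fin _ → Fin k} → Proper graph c → ∀ {i i′} y a a′ → i ≢ i′ →
                      c (from (core i y a)) ≢ c (from (core i′ y a′))
  core-parts-differ proper {i} {i′} y a a′ i≢i′ =
    proper {from (core i y a)} {from (core i′ y a′)}
      (~⇒Adj {core i y a} {core i′ y a′} (i≢i′ , refl))

  -- The chromatic number.

  n≤colours : Fin L → Fin m → ∀ {k} → Colourable graph k → n ≤ k
  n≤colours y a (c , proper) = injective⇒≤ {f = λ i → c (from (core i y a))} clique
    where
    -- One vertex from each part of a single copy gives `n` pairwise adjacent vertices.
    clique : Injective _≡_ _≡_ (λ i → c (from (core i y a)))
    clique {i} {i′} eq with i ≟ i′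
    ... | yes i≡i′ = i≡i′
    ... | no i≢i′ = contradiction eq (core-parts-differ proper y a a i≢i′)

  part : Vertex → Fin n
  part (core i _ _)  = i
  -- A hub of part `i` sees only core vertices of part `i`, so any other part serves; one exists
  -- since `n` is at least 2.
  part (hub i _ _ _) = punchIn i zero

  part-proper : ∀ {v w} → v ~ w → part v ≢ part w
  part-proper {core _ _ _}  {core _ _ _}  (i≢i′ , _) = i≢i′
  part-proper {core i _ _}  {hub _ _ _ _} (refl , _) = punchInᵢ≢i i zero ∘ sym
  part-proper {hub i _ _ _} {core _ _ _}  (refl , _) = punchInᵢ≢i i zero

  colourable : Colourable graph n
  colourable = part ∘ to , λ {u} {v} → part-proper {to u} {to v}

  -- The dynamic colouring with rn colours.

  all-of-some-core : Fin n → ∀ v → ∃[ i ] ∃[ y ] (∀ a → v ~ core i y a)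
  all-of-some-core j (core i y _)  = punchIn i zero , y , λ _ → punchInᵢ≢i i zero ∘ sym , refl
  all-of-some-core j (hub i x e _) = i , x ⊕ offset e j , λ _ → refl , j , refl

  module _ (r : ℕ) .{{_ : NonZero r}} (r≤m : r ≤ m) where

    -- Splits each part into `r` colours, all of which occur because `r ≤ m`. Every vertex is
    -- adjacent to a whole part of some copy and so sees `r` colours; the shade of a hub is
    -- arbitrary.
    shade : Vertex → Fin r
    shade (core _ _ a)  = toℕ a mod r
    shade (hub _ _ _ _) = 0 mod r

    shade-core : ∀ i y t → shade (core i y (inject≤ t r≤m)) ≡ t
    shade-core i y t = toℕ-injective (trans (toℕ-fromℕ< _)
      (trans (cong (_% r) (toℕ-inject≤ t r≤m)) (m<n⇒m%n≡m (toℕ<n t))))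

    colour : Vertex → Fin (r * n)
    colour v = combine (shade v) (part v)

    dynamic-colourable : DynamicColourable graph r (r * n)
    dynamic-colourable = colour ∘ to , proper , dynamic
      where
      proper : Proper graph (colour ∘ to)
      proper {u} {v} u~v eq =
        part-proper {to u} {to v} u~v (proj₂
          (combine-injective (shade (to u)) (part (to u)) (shade (to v)) (part (to v)) eq))

      dynamic : ∀ v → r ⊓ degree graph v ≤ ∣ image (colour ∘ to) (N graph v) ∣
      dynamic v with all-of-some-core zero (to v)
      ... | i , y , v~core = ≤-trans (m⊓n≤m r _)
        (injection⇒≤ (neighbour-colours (colour ∘ to) v)
          (λ t → combine t i)
          (λ {t} {t′} eq → proj₁ (combine-injective t i t′ i eq))
          (λ t → core i y (inject≤ t r≤m) , v~core _
               , trans (cong colour (to∘from (core i y (inject≤ t r≤m))))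
                       (cong (λ s → combine s i) (shade-core i y t))))

    -- The lower bound for dynamic colourings.

    module _ (b : Fin q)
      (realised : ∀ (f : Fin n → Fin L) → Injective _≡_ _≡_ f →
                  ∃[ x ] ∃[ e ] ∀ j → x ⊕ offset e j ≡ f j)
      {k} (large : 2 ^ (n * k) * n₀ < L) (c : Fin _ → Fin k) (c-dynamic : Dynamic graph r c) where

      _Shows_ : Fin L → Pred (Fin n × Fin k) 0ℓ
      y Shows (i , κ) = ∃[ a ] c (from (core i y a)) ≡ κ

      shows? : ∀ y → Decidable (λ z → y Shows remQuot {n} k z)
      shows? y z = let i , κ = remQuot {n} k z in any? (λ a → c (from (core i y a)) ≟ κ)

      -- Numbers the set of pairs (part, colour) shown by a copy; positions and multiplicities are
      -- forgotten, so the number of palettes is independent of `m` and `L`.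
      palette : Fin L → Fin (2 ^ (n * k))
      palette y = code (shows? y)

      palette-⊆ : ∀ {y y′} → palette y ≡ palette y′ → ∀ {i κ} → y Shows (i , κ) → y′ Shows (i , κ)
      palette-⊆ {y} {y′} eq {i} {κ} s =
        subst (y′ Shows_) (remQuot-combine i κ)
          (code-⊆ (shows? y) (shows? y′) eq (combine i κ)
            (subst (y Shows_) (sym (remQuot-combine i κ)) s))

      -- As `L` exceeds `n₀` times the number of palettes, some palette is shared by at least
      -- `suc n₀`, that is `n`, copies.
      same-palette : ∃[ f ] (Injective _≡_ _≡_ f × (∀ i j → palette (f i) ≡ palette (f j)))
      same-palette with strong-pigeonhole large palette
      ... | κ , n≤ = (λ j → element class (inject≤ j n≤))
                   , (λ eq → inject≤-injective n≤ n≤ _ _ (injective class eq))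
                   , λ i j → trans (sound class _) (sym (sound class _))
        where class = enumerate (λ y → palette y ≟ κ)

      ShowsDistinct : Fin L → Fin n → Set
      ShowsDistinct y i = ∃[ g ] (Injective {A = Fin r} _≡_ _≡_ g × (∀ t → y Shows (i , g t)))

      -- For each part `i`, a hub joined to the copies `f j` sees `r` colours, and equal palettes
      -- move all of them to part `i` of the single copy `f zero`.
      rainbow : ∃[ y ] ∀ i → ShowsDistinct y i
      rainbow with same-palette
      ... | f , f-inj , same with realised f f-inj
      ...   | x , e , meets = f zero , shades
        where
        shades : ∀ i → ShowsDistinct (f zero) i
        shades i = element colours ∘ (λ t → inject≤ t r≤)
                 , (λ eq → inject≤-injective r≤ r≤ _ _ (injective colours eq))
                 , λ t → shown (sound colours (inject≤ t r≤))
          where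
          v : Fin _
          v = from (hub i x e b)

          colours = neighbour-colours c v

          r≤ : r ≤ ∣ image c (N graph v) ∣
          -- The hub has degree `n * m`, which is at least `r`, so the minimum in the dynamic
          -- condition is `r` itself.
          r≤ = ≤-trans (≤-reflexive (sym (trans (cong (r ⊓_) (regular v))
                         (m≤n⇒m⊓n≡m (≤-trans r≤m (m≤n*m m n))))))
                       (proj₂ c-dynamic v)

          shown′ : ∀ {κ} w → hub i x e b ~ w → c (from w) ≡ κ → f zero Shows (i , κ)
          shown′ (core _ y a) (refl , j , refl) c≡κ = palette-⊆ (same j zero)
            (a , trans (cong (λ z → c (from (core i z a))) (sym (meets j))) c≡κ)

          shown : ∀ {κ} → ∃[ w ] (to v ~ w × c (from w) ≡ κ) → f zero Shows (i , κ)
          shown (w , v~w , c≡κ) = shown′ w (subst (_~ w) (to∘from (hub i x e b)) v~w) c≡κ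

      -- The `r` colours chosen on one part are distinct, and colours on different parts of a copy
      -- differ by adjacency, so the pairs (shade, part) inject into the colours.
      rainbow⇒rn≤k : ∀ y → (∀ i → ShowsDistinct y i) → r * n ≤ k
      rainbow⇒rn≤k y shades = ×-injective⇒*≤ h h-injective
        where
        h : Fin r × Fin n → Fin k
        h (t , i) = proj₁ (shades i) t

        differ : ∀ {i i′ κ κ′} → i ≢ i′ → y Shows (i , κ) → y Shows (i′ , κ′) → κ ≢ κ′
        differ i≢i′ (a , refl) (a′ , refl) = core-parts-differ (proj₁ c-dynamic) y a a′ i≢i′

        h-injective : ∀ s s′ → h s ≡ h s′ → s ≡ s′
        h-injective (t , i) (t′ , i′) eq with i ≟ i′
        ... | yes refl = cong (_, i) (proj₁ (proj₂ (shades i)) eq)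
        ... | no i≢i′ = contradiction eq
          (differ i≢i′ (proj₂ (proj₂ (shades i)) t) (proj₂ (proj₂ (shades i′)) t′))

      rn≤k : r * n ≤ k
      rn≤k = rainbow⇒rn≤k (proj₁ rainbow) (proj₂ rainbow)

-- A list of all injections.

injective? : ∀ {n l} (f : Fin n → Fin l) → Dec (∀ i j → f i ≡ f j → i ≡ j)
injective? f = all? (λ i → all? (λ j → (f i ≟ f j) →-dec (i ≟ j)))

module Injections {n l} (n≤l : n ≤ l) where

  -- Runs through all functions, with a fixed injection in place of each non-injective one. Every
  -- entry is then injective, and no injection is lost; repetitions are harmless.
  injection : Fin (l ^ n) → Fin n → Fin l
  injection e with injective? (finToFun {l} {n} e)
  ... | yes _ = finToFun e
  ... | no _  = λ j → inject≤ j n≤l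

  injection-injective : ∀ e → Injective _≡_ _≡_ (injection e)
  injection-injective e eq with injective? (finToFun {l} {n} e)
  ... | yes inj = inj _ _ eq
  ... | no _    = inject≤-injective n≤l n≤l _ _ eq

  injection-funToFin : ∀ (f : Fin n → Fin l) → Injective _≡_ _≡_ f →
                       ∀ j → injection (funToFin f) j ≡ f j
  injection-funToFin f f-inj j with injective? (finToFun {l} {n} (funToFin f))
  ... | yes _ = finToFun-funToFin f j
  ... | no ¬inj = contradiction
    (λ i j eq → f-inj (trans (sym (finToFun-funToFin f i)) (trans eq (finToFun-funToFin f j)))) ¬inj

-- Choice of the parameters.

module Witness (r n₁ δ L : ℕ) .{{_ : NonZero r}} .{{_ : NonZero L}}
  (n≤L : suc (suc n₁) ≤ L)
  (large : 2 ^ (suc (suc n₁) * (r * suc (suc n₁))) * suc n₁ < L) where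

  open Injections n≤L
  -- Taking `q = r + δ` ensures both `r ≤ m` and `δ < m`, as `m` is a positive multiple of `q`.
  open Construction n₁ (r + δ) L (L ^ suc (suc n₁)) injection injection-injective
  open Cyclic L using (_⊕_; 0#; ⊕-identityˡ)

  q≤m : r + δ ≤ m
  q≤m = ≤-trans (m≤n*m (r + δ) n) (m≤n*m (n * (r + δ)) (L ^ n) {{m^n≢0 L n}})

  r≤m : r ≤ m
  r≤m = ≤-trans (m≤m+n r δ) q≤m

  δ<m : δ < m
  δ<m = ≤-trans (+-monoˡ-≤ δ (>-nonZero⁻¹ r)) q≤m

  realised : ∀ (f : Fin n → Fin L) → Injective _≡_ _≡_ f →
             ∃[ x ] ∃[ e ] ∀ j → x ⊕ injection e j ≡ f j
  -- The choices already include every injection, so the zero translate suffices here; the other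
  -- translates serve regularity.
  realised f f-inj = 0# , funToFin f , λ j →
    trans (⊕-identityˡ _) (injection-funToFin f f-inj j)

  -- `L` is fixed before `k`, but only `k < r * n` has to be refuted, and then the number of
  -- palettes is at most that for `r * n` colours, which `large` covers.
  rn-least : ∀ {k} → DynamicColourable graph r k → r * n ≤ k
  rn-least {k} (c , c-dynamic) = ≮⇒≥ λ k<rn → <⇒≱ k<rn
    (rn≤k r r≤m (inject≤ (0 mod r) (m≤m+n r δ)) realised
      (≤-<-trans (*-monoˡ-≤ n₀ (^-monoʳ-≤ 2 (*-monoʳ-≤ n (<⇒≤ k<rn)))) large) c c-dynamic)

  witness : ∃[ G ] ∃[ d ] (Regular G d × δ < d × ChromaticNumber G (suc (suc n₁)) ×
                           DynamicChromaticNumber r G (r * suc (suc n₁)))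
  witness = graph , n * m , regular , ≤-trans δ<m (m≤n*m m n)
          , (colourable , n≤colours 0# (inject≤ (0 mod r) r≤m))
          , (dynamic-colourable r r≤m , rn-least)

theorem1p3 : ∀ (r n δ : ℕ) → 2 ≤ r → 2 ≤ n → 2 ≤ δ →
    ∃[ G ] ∃[ d ] (Regular G d × δ < d × ChromaticNumber G n × DynamicChromaticNumber r G (r * n))
theorem1p3 (suc r₀) (suc zero)     δ _ (s≤s ()) _
theorem1p3 (suc r₀) (suc (suc n₁)) δ _ _ _ =
  -- `K` counts the palettes with `r * n` colours. This `L` is the least one exceeding `K * suc n₁`,
  -- and it is at least `n` because `K` is positive.
  Witness.witness (suc r₀) n₁ δ (suc (K * suc n₁))
    (s≤s (m≤n*m (suc n₁) K {{m^n≢0 2 K-exponent}})) ≤-refl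
  where
  K-exponent K : ℕ
  K-exponent = suc (suc n₁) * (suc r₀ * suc (suc n₁))
  K = 2 ^ K-exponent
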